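{- Let $G$ be a graph with $n$ vertices and $m$ edges such that its complement $\overline{G}$ is connected. Then $$S_1(\overline{G})\ \ge\ (n-1)\left[n(n-1)-2m\right]+\overline{M_1}(G)$$ and $$S_2(\overline{G})\ \ge\ (n-1)^2\left[\frac{n(n-1)}{2}-m\right]+(n-1)\overline{M_1}(G)+\overline{M_2}(G).$$ In each of these two inequalities, equality holds if and only if $\mathrm{diam}(\overline{G})\le 2$.
   Context: Graphs are finite and simple, with vertex set $V(G)$ and edge set $E(G)$; $d_G(u)$ is the degree of $u$ in $G$. For a connected graph $H$, $d_H(u,v)$ is the shortest-path distance, the status of a vertex is $\sigma_H(u)=\sum_{v\in V(H)}d_H(u,v)$, and $S_1(H)=\sum_{uv\in E(H)}[\sigma_H(u)+\sigma_H(v)]$, $S_2(H)=\sum_{uv\in E(H)}\sigma_H(u)\sigma_H(v)$. The Zagreb co-indices of a graph $G$ (not necessarily connected) are $\overline{M_1}(G)=\sum_{uv\notin E(G)}[d_G(u)+d_G(v)]$ and $\overline{M_2}(G)=\sum_{uv\notin E(G)}d_G(u)d_G(v)$, where the sums over $uv\notin E(G)$ range over unordered pairs of distinct non-adjacent vertices. -}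

module Defs where

open import Data.Fin.Base using (Fin)
open import Data.Fin.Properties using (_≟_; _<?_; any?)
open import Data.List.Base
  using (List; []; _∷_; allFin; cartesianProduct; filter; length; map)
open import Data.List.Extrema.Nat using (max)
open import Data.List.Relation.Unary.Unique.Propositional using (Unique)
open import Data.List.Relation.Unary.Unique.DecPropositional using (unique?)
open import Data.Nat.Base using (ℕ; zero; suc; _+_; _*_; _≤_; z≤n; s≤s)
open import Data.Nat.ListAction using (sum)
open import Data.Product.Base using (∃; _×_; _,_; proj₁; uncurry)
open import Function.Base using (_∘_)
open import Level using (0ℓ)
open import Relation.Binary.Core using (Rel)
open import Relation.Binary.Definitions using (Decidable; Irreflexive; Symmetric)
open import Relation.Binary.PropositionalEquality using (_≡_; _≢_; refl; sym)
open import Relation.Nullary.Decidable using (Dec; yes; no; map′; ¬?; _×-dec_)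
open import Relation.Nullary.Negation using (¬_; contradiction)
open import Relation.Unary using (Pred) renaming (Decidable to Decidable₁)

record Graph (n : ℕ) : Set₁ where
  field
    Adj        : Rel (Fin n) 0ℓ
    adj?       : Decidable Adj
    adj-sym    : Symmetric Adj
    adj-irrefl : Irreflexive _≡_ Adj

open Graph public

complement : ∀ {n} → Graph n → Graph n
complement G = record
  { Adj        = λ u v → u ≢ v × ¬ Adj G u v
  ; adj?       = λ u v → ¬? (u ≟ v) ×-dec ¬? (adj? G u v)
  ; adj-sym    = λ (u≢v , u≁v) → (u≢v ∘ sym) , (u≁v ∘ adj-sym G)
  ; adj-irrefl = λ u≡v (u≢v , _) → u≢v u≡v
  }

-- An unordered pair of distinct vertices is represented by the unique
-- ordering (u , v) of it with u < v, so each pair is listed exactly once.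
edges : ∀ {n} → Graph n → List (Fin n × Fin n)
edges {n} G =
  filter (λ (u , v) → (u <? v) ×-dec adj? G u v) (cartesianProduct (allFin n) (allFin n))

nonEdges : ∀ {n} → Graph n → List (Fin n × Fin n)
nonEdges {n} G =
  filter (λ (u , v) → (u <? v) ×-dec ¬? (adj? G u v)) (cartesianProduct (allFin n) (allFin n))

degree : ∀ {n} → Graph n → Fin n → ℕ
degree {n} G u = length (filter (adj? G u) (allFin n))

M̄₁ : ∀ {n} → Graph n → ℕ
M̄₁ G = sum (map (λ (u , v) → degree G u + degree G v) (nonEdges G))

M̄₂ : ∀ {n} → Graph n → ℕ
M̄₂ G = sum (map (λ (u , v) → degree G u * degree G v) (nonEdges G))

-- The last index is the length, i.e. the number of edges traversed.
data Walk {n} (G : Graph n) : Fin n → Fin n → ℕ → Set where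
  []  : ∀ {u} → Walk G u u 0
  _∷_ : ∀ {u v w k} → Adj G u v → Walk G v w k → Walk G u w (suc k)

vertices : ∀ {n} {G : Graph n} {u v k} → Walk G u v k → List (Fin n)
vertices {u = u} []      = u ∷ []
vertices {u = u} (_ ∷ p) = u ∷ vertices p

Path : ∀ {n} → Graph n → Fin n → Fin n → ℕ → Set
Path G u v k = ∃ λ (p : Walk G u v k) → Unique (vertices p)

Connected : ∀ {n} → Graph n → Set
Connected G = ∀ u v → ∃ λ k → Path G u v k

walkWith? : ∀ {n} (G : Graph n) {P : Pred (List (Fin n)) 0ℓ} → Decidable₁ P →
            ∀ u v k → Dec (∃ λ (p : Walk G u v k) → P (vertices p))
walkWith? G P? u v zero with u ≟ v
... | yes refl = map′ (λ pu → [] , pu) (λ { ([] , pu) → pu }) (P? (u ∷ []))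
... | no  u≢v  = no λ { ([] , _) → u≢v refl }
walkWith? G P? u v (suc k) =
  map′ (λ (_ , a , p , pp) → a ∷ p , pp)
       (λ { (a ∷ p , pp) → _ , a , p , pp })
       (any? λ w → adj? G u w ×-dec walkWith? G (λ xs → P? (u ∷ xs)) w v k)

path? : ∀ {n} (G : Graph n) u v k → Dec (Path G u v k)
path? G = walkWith? G (unique? _≟_)

least : {P : Pred ℕ 0ℓ} → Decidable₁ P → ∀ k → P k →
        ∃ λ d → P d × (∀ j → P j → d ≤ j)
least P? zero    p = 0 , p , λ _ _ → z≤n
least P? (suc k) p with P? 0
... | yes q = 0 , q , λ _ _ → z≤n
... | no ¬q with least (P? ∘ suc) k p
...   | d , r , d≤ = suc d , r , λ
  { zero    q → contradiction q ¬q
  ; (suc j) q → s≤s (d≤ j q)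
  }

shortestPath : ∀ {n} (G : Graph n) → Connected G → ∀ u v →
               ∃ λ d → Path G u v d × (∀ j → Path G u v j → d ≤ j)
shortestPath G conn u v = uncurry (least (path? G u v)) (conn u v)

-- The connectedness proof only guarantees that the search for a shortest
-- path stops; by minimality the value does not depend on it.
dist : ∀ {n} (G : Graph n) → Connected G → Fin n → Fin n → ℕ
dist G conn u v = proj₁ (shortestPath G conn u v)

diam : ∀ {n} (G : Graph n) → Connected G → ℕ
diam {n} G conn = max 0 (map (uncurry (dist G conn)) (cartesianProduct (allFin n) (allFin n)))

status : ∀ {n} (G : Graph n) → Connected G → Fin n → ℕ
status {n} G conn u = sum (map (dist G conn u) (allFin n))

S₁ : ∀ {n} (G : Graph n) → Connected G → ℕ
S₁ G conn = sum (map (λ (u , v) → status G conn u + status G conn v) (edges G))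

S₂ : ∀ {n} (G : Graph n) → Connected G → ℕ
S₂ G conn = sum (map (λ (u , v) → status G conn u * status G conn v) (edges G))

{-# OPTIONS --safe #-}

-- In H = complement G, a vertex v is at distance at least
-- [u ≢ v] + [u ~ v in G] from u, with equality exactly when d(u , v) ≤ 2.
-- Summing over v gives σ(u) ≥ (n - 1) + deg u, and summing this bound over the
-- edges of H, which are the non-edges of G, gives both inequalities.  If one
-- of them is tight, then so is the bound on σ(u) for every u that lies on an
-- edge of H.  When n ≥ 2 this is every vertex, as H is connected, so
-- all distances are at most 2.
module Submission where

open import Defs
open import Data.Nat.Base using (ℕ; _+_; _*_; _∸_; _^_; _/_; _≤_; _≥_)
open import Data.List.Base using (length)
open import Data.Product.Base using (_×_)
open import Function.Bundles using (_⇔_)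
open import Relation.Binary.PropositionalEquality using (_≡_)

open import Data.Bool.Base using (if_then_else_)
open import Data.Fin.Base as Fin using (Fin)
open import Data.Fin.Properties as Fin using (_≟_; _<?_)
open import Data.List.Base
  using (List; []; _∷_; _++_; allFin; cartesianProduct; filter; map)
open import Data.List.Extrema.Nat using (max≤v⁺; xs≤max)
open import Data.List.Membership.Propositional using (_∈_)
open import Data.List.Membership.Propositional.Properties
  using (∈-allFin; ∈-cartesianProduct⁺; ∈-filter⁺)
open import Data.List.Properties
  using (filter-≐; length-tabulate; map-++; map-∘; map-cong; map-tabulate)
open import Data.List.Relation.Unary.All as All using ([]; _∷_)
import Data.List.Relation.Unary.All.Properties as All
open import Data.List.Relation.Unary.AllPairs using ([]; _∷_)
open import Data.List.Relation.Unary.Any using (here; there)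
open import Data.Nat.Base using (suc; z≤n; s≤s; NonZero)
open import Data.Nat.DivMod using (m*n/n≡m)
open import Data.Nat.ListAction using (sum)
open import Data.Nat.ListAction.Properties using (sum-++)
open import Data.Nat.Properties
  using ( +-identityʳ; *-comm; *-identityʳ; *-distribˡ-+; m+n∸m≡n
        ; ≤-reflexive; ≤-trans; ≤-antisym; <⇒≢; m≤n⇒m<n∨m≡n; <-≤-trans
        ; +-mono-≤; +-mono-<-≤; +-mono-≤-<; *-mono-≤; *-monoˡ-<; *-monoʳ-≤ )
open import Data.Nat.Tactic.RingSolver using (solve-∀)
open import Data.Product.Base using (_,_; proj₁; proj₂; uncurry)
open import Data.Sum.Base using (inj₁; inj₂)
open import Function.Base using (_∘_)
open import Function.Bundles using (mk⇔)
open import Function.Properties.Equivalence using () renaming (trans to ⇔-trans; sym to ⇔-sym)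
open import Level using (0ℓ)
open import Relation.Binary.Definitions using (tri<; tri≈; tri>)
open import Relation.Binary.PropositionalEquality
  using (_≢_; refl; sym; trans; cong; cong₂; module ≡-Reasoning)
open import Relation.Nullary.Decidable using (Dec; yes; no; does; ¬?; _×-dec_)
open import Relation.Nullary.Negation using (¬_; contradiction)
open import Relation.Unary using (Pred) renaming (Decidable to Decidable₁)

private
  variable
    A B P Q : Set

-- Finite sums over lists.

∑ : List A → (A → ℕ) → ℕ
∑ xs f = sum (map f xs)

syntax ∑ xs (λ x → e) = ∑[ x ∈ xs ] e

∑-cong : ∀ {f g : A → ℕ} → (∀ x → f x ≡ g x) → ∀ xs → ∑ xs f ≡ ∑ xs g
∑-cong f≡g xs = cong sum (map-cong f≡g xs)

∑-+ : ∀ (f g : A → ℕ) xs → (∑[ x ∈ xs ] (f x + g x)) ≡ ∑ xs f + ∑ xs g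
∑-+ f g []       = refl
∑-+ f g (x ∷ xs) rewrite ∑-+ f g xs = interchange (f x) (g x) (∑ xs f) (∑ xs g)
  where
  interchange : ∀ a b c d → (a + b) + (c + d) ≡ (a + c) + (b + d)
  interchange = solve-∀

∑-const : ∀ c (xs : List A) → (∑[ _ ∈ xs ] c) ≡ length xs * c
∑-const c []       = refl
∑-const c (_ ∷ xs) = cong (c +_) (∑-const c xs)

∑-swap : ∀ (f : A → B → ℕ) xs ys →
         (∑[ x ∈ xs ] ∑[ y ∈ ys ] f x y) ≡ (∑[ y ∈ ys ] ∑[ x ∈ xs ] f x y)
∑-swap f []       ys = sym (∑0≡0 ys)
  where
  ∑0≡0 : (ys : List B) → (∑[ _ ∈ ys ] 0) ≡ 0
  ∑0≡0 []       = refl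
  ∑0≡0 (_ ∷ ys) = ∑0≡0 ys
∑-swap f (x ∷ xs) ys =
  trans (cong (∑ ys (f x) +_) (∑-swap f xs ys))
        (sym (∑-+ (f x) (λ y → ∑[ z ∈ xs ] f z y) ys))

∑-cartesianProduct : ∀ (f : A × B → ℕ) xs ys →
                     ∑ (cartesianProduct xs ys) f ≡ (∑[ x ∈ xs ] ∑[ y ∈ ys ] f (x , y))
∑-cartesianProduct f []       ys = refl
∑-cartesianProduct f (x ∷ xs) ys = begin
  sum (map f (map (x ,_) ys ++ cartesianProduct xs ys))
    ≡⟨ cong sum (map-++ f (map (x ,_) ys) _) ⟩
  sum (map f (map (x ,_) ys) ++ map f (cartesianProduct xs ys))
    ≡⟨ sum-++ (map f (map (x ,_) ys)) _ ⟩
  sum (map f (map (x ,_) ys)) + ∑ (cartesianProduct xs ys) f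
    ≡⟨ cong₂ _+_ (cong sum (sym (map-∘ ys))) (∑-cartesianProduct f xs ys) ⟩
  (∑[ y ∈ ys ] f (x , y)) + (∑[ x ∈ xs ] ∑[ y ∈ ys ] f (x , y)) ∎
  where open ≡-Reasoning

∑-mono-≤ : ∀ {f g : A → ℕ} → (∀ x → f x ≤ g x) → ∀ xs → ∑ xs f ≤ ∑ xs g
∑-mono-≤ f≤g []       = z≤n
∑-mono-≤ f≤g (x ∷ xs) = +-mono-≤ (f≤g x) (∑-mono-≤ f≤g xs)

-- Equality cases of monotone sums and products.

+-tight : ∀ {a b c d} → a ≤ c → b ≤ d → c + d ≡ a + b → c ≡ a × d ≡ b
+-tight a≤c b≤d eq with m≤n⇒m<n∨m≡n a≤c | m≤n⇒m<n∨m≡n b≤d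
... | inj₁ a<c | _        = contradiction (sym eq) (<⇒≢ (+-mono-<-≤ a<c b≤d))
... | inj₂ _   | inj₁ b<d = contradiction (sym eq) (<⇒≢ (+-mono-≤-< a≤c b<d))
... | inj₂ a≡c | inj₂ b≡d = sym a≡c , sym b≡d

-- If a < c, then a b < c b ≤ c d, where the strict step rests on b being positive.
*-tightˡ : ∀ {a b c d} .{{_ : NonZero b}} → a ≤ c → b ≤ d → c * d ≡ a * b → c ≡ a
*-tightˡ {b = b} {c} a≤c b≤d eq with m≤n⇒m<n∨m≡n a≤c
... | inj₁ a<c = contradiction (sym eq) (<⇒≢ (<-≤-trans (*-monoˡ-< b a<c) (*-monoʳ-≤ c b≤d)))
... | inj₂ a≡c = sym a≡c

-- By `+-tight`, equal totals force equality both at the head and between the sums over the tails,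
-- so tightness descends to every entry.
∑-tight : ∀ {f g : A → ℕ} → (∀ x → f x ≤ g x) → ∀ {xs} → ∑ xs g ≡ ∑ xs f →
          ∀ {x} → x ∈ xs → g x ≡ f x
∑-tight f≤g {y ∷ ys} eq x∈ with +-tight (f≤g y) (∑-mono-≤ f≤g ys) eq | x∈
... | gy≡fy , _  | here refl = gy≡fy
... | _     , eq | there x∈ys = ∑-tight f≤g eq x∈ys

-- Indicators and counting pairs of indices.

𝟙 : Dec P → ℕ
𝟙 P? = if does P? then 1 else 0

𝟙-yes : ∀ (P? : Dec P) → P → 𝟙 P? ≡ 1
𝟙-yes (yes _) _ = refl
𝟙-yes (no ¬p) p = contradiction p ¬p

𝟙-no : ∀ (P? : Dec P) → ¬ P → 𝟙 P? ≡ 0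
𝟙-no (yes p) ¬p = contradiction p ¬p
𝟙-no (no _)  _  = refl

𝟙-split : ∀ (P? : Dec P) (Q? : Dec Q) → 𝟙 (P? ×-dec Q?) + 𝟙 (P? ×-dec ¬? Q?) ≡ 𝟙 P?
𝟙-split (yes _) (yes _) = refl
𝟙-split (yes _) (no _)  = refl
𝟙-split (no _)  _       = refl

length-filter≡∑ : ∀ {P : Pred A 0ℓ} (P? : Decidable₁ P) xs →
                  length (filter P? xs) ≡ (∑[ x ∈ xs ] 𝟙 (P? x))
length-filter≡∑ P? []       = refl
length-filter≡∑ P? (x ∷ xs) with P? x
... | yes _ = cong suc (length-filter≡∑ P? xs)
... | no  _ = length-filter≡∑ P? xs

∑-allFin-suc : ∀ {n} (f : Fin (suc n) → ℕ) →
               ∑ (allFin (suc n)) f ≡ f Fin.zero + (∑[ i ∈ allFin n ] f (Fin.suc i))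
∑-allFin-suc f = cong (λ xs → f Fin.zero + sum xs)
  (trans (map-tabulate Fin.suc f) (sym (map-tabulate (λ i → i) (f ∘ Fin.suc))))

∑-≢ : ∀ {n} (u : Fin n) → (∑[ v ∈ allFin n ] 𝟙 (¬? (u ≟ v))) ≡ n ∸ 1
∑-≢ {suc n} Fin.zero = begin
  (∑[ v ∈ allFin (suc n) ] 𝟙 (¬? (Fin.zero {n} ≟ v))) ≡⟨ ∑-allFin-suc {n} (λ v → 𝟙 (¬? (Fin.zero ≟ v))) ⟩
  (∑[ _ ∈ allFin n ] 1)                               ≡⟨ ∑-const 1 (allFin n) ⟩
  length (allFin n) * 1                               ≡⟨ *-identityʳ _ ⟩
  length (allFin n)                                   ≡⟨ length-tabulate {n = n} (λ i → i) ⟩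
  n                                                   ∎
  where open ≡-Reasoning
-- The index `zero` differs from `suc u` and contributes 1. On the other indices the indicators for
-- `suc u` reduce to those for `u`, because `𝟙` looks only at `does`. Splitting off two successors
-- lets both truncated subtractions compute.
∑-≢ {suc (suc n)} (Fin.suc u) =
  trans (∑-allFin-suc (λ v → 𝟙 (¬? (Fin.suc u ≟ v)))) (cong suc (∑-≢ u))

-- Double counting: exchanging the two summations shows that the pairs with u < v are as many as
-- those with v < u. By trichotomy the two kinds together fill each row u with the n - 1 indices
-- different from u.
∑-<-pairs : ∀ n → 2 * (∑[ (u , v) ∈ cartesianProduct (allFin n) (allFin n) ] 𝟙 (u <? v))
                  ≡ n * (n ∸ 1)
∑-<-pairs n = begin
  2 * (∑[ (u , v) ∈ cartesianProduct V V ] 𝟙 (u <? v))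
    ≡⟨ cong (2 *_) (∑-cartesianProduct (λ (u , v) → 𝟙 (u <? v)) V V) ⟩
  2 * (∑[ u ∈ V ] ∑[ v ∈ V ] 𝟙 (u <? v))
    ≡⟨ cong (T +_) (+-identityʳ T) ⟩
  T + T
    ≡⟨ cong (T +_) (∑-swap (λ u v → 𝟙 (u <? v)) V V) ⟩
  T + (∑[ u ∈ V ] ∑[ v ∈ V ] 𝟙 (v <? u))
    ≡⟨ ∑-+ (λ u → ∑[ v ∈ V ] 𝟙 (u <? v)) (λ u → ∑[ v ∈ V ] 𝟙 (v <? u)) V ⟨
  (∑[ u ∈ V ] ((∑[ v ∈ V ] 𝟙 (u <? v)) + (∑[ v ∈ V ] 𝟙 (v <? u))))
    ≡⟨ ∑-cong row V ⟩
  (∑[ _ ∈ V ] (n ∸ 1))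
    ≡⟨ ∑-const (n ∸ 1) V ⟩
  length V * (n ∸ 1)
    ≡⟨ cong (_* (n ∸ 1)) (length-tabulate {n = n} (λ i → i)) ⟩
  n * (n ∸ 1) ∎
  where
  open ≡-Reasoning
  V : List (Fin n)
  V = allFin n
  T : ℕ
  T = ∑[ u ∈ V ] ∑[ v ∈ V ] 𝟙 (u <? v)
  trichotomy : ∀ (u v : Fin n) → 𝟙 (u <? v) + 𝟙 (v <? u) ≡ 𝟙 (¬? (u ≟ v))
  trichotomy u v with Fin.<-cmp u v
  ... | tri< u<v u≢v v≮u = trans (cong₂ _+_ (𝟙-yes (u <? v) u<v) (𝟙-no (v <? u) v≮u))
                                 (sym (𝟙-yes (¬? (u ≟ v)) u≢v))
  ... | tri≈ u≮v u≡v v≮u = trans (cong₂ _+_ (𝟙-no (u <? v) u≮v) (𝟙-no (v <? u) v≮u))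
                                 (sym (𝟙-no (¬? (u ≟ v)) (contradiction u≡v)))
  ... | tri> u≮v u≢v v<u = trans (cong₂ _+_ (𝟙-no (u <? v) u≮v) (𝟙-yes (v <? u) v<u))
                                 (sym (𝟙-yes (¬? (u ≟ v)) u≢v))
  row : ∀ u → (∑[ v ∈ V ] 𝟙 (u <? v)) + (∑[ v ∈ V ] 𝟙 (v <? u)) ≡ n ∸ 1
  row u = trans (sym (∑-+ (λ v → 𝟙 (u <? v)) (λ v → 𝟙 (v <? u)) V))
                (trans (∑-cong (trichotomy u) V) (∑-≢ u))

-- Extracting a constant from sums over pairs.

∑-shift-+ : ∀ p (d : A → ℕ) (es : List (A × A)) →
            (∑[ (u , v) ∈ es ] ((p + d u) + (p + d v)))
            ≡ p * (2 * length es) + (∑[ (u , v) ∈ es ] (d u + d v))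
∑-shift-+ p d []             = sym (trans (+-identityʳ _) (*-comm p 0))
∑-shift-+ p d ((u , v) ∷ es) rewrite ∑-shift-+ p d es =
  step p (d u) (d v) (length es) (∑[ (u , v) ∈ es ] (d u + d v))
  where
  step : ∀ p a b l s → ((p + a) + (p + b)) + (p * (2 * l) + s)
                       ≡ p * (2 * (1 + l)) + ((a + b) + s)
  step = solve-∀

-- Each product expands as p² + p (a + b) + a b. With p = n - 1 and `d` the degree, summed over
-- non-edges, the last two terms yield the two Zagreb co-indices.
∑-shift-* : ∀ p (d : A → ℕ) (es : List (A × A)) →
            (∑[ (u , v) ∈ es ] ((p + d u) * (p + d v)))
            ≡ p ^ 2 * length es + p * (∑[ (u , v) ∈ es ] (d u + d v))
              + (∑[ (u , v) ∈ es ] (d u * d v))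
∑-shift-* p d []             = base p
  where
  base : ∀ p → 0 ≡ p * (p * 1) * 0 + p * 0 + 0
  base = solve-∀
∑-shift-* p d ((u , v) ∷ es) rewrite ∑-shift-* p d es =
  step p (d u) (d v) (length es) (∑[ (u , v) ∈ es ] (d u + d v)) (∑[ (u , v) ∈ es ] (d u * d v))
  where
  step : ∀ p a b l s t →
         (p + a) * (p + b) + (p * (p * 1) * l + p * s + t)
         ≡ p * (p * 1) * (1 + l) + p * ((a + b) + s) + (a * b + t)
  step = solve-∀

-- Counting edges and non-edges.

edges-complement : ∀ {n} (G : Graph n) → edges (complement G) ≡ nonEdges G
edges-complement {n} G = filter-≐
  (λ (u , v) → (u <? v) ×-dec adj? (complement G) u v)
  (λ (u , v) → (u <? v) ×-dec ¬? (adj? G u v))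
  ( (λ (u<v , _ , u≁v) → u<v , u≁v)
  -- The ordering u < v supplies the distinctness that adjacency in the complement demands.
  , (λ (u<v , u≁v) → u<v , Fin.<⇒≢ u<v , u≁v) )
  (cartesianProduct (allFin n) (allFin n))

-- Every pair with u < v passes exactly one of the two filters, so their indicators add up to that
-- of u < v.
length-edges+nonEdges : ∀ {n} (G : Graph n) →
  2 * length (edges G) + 2 * length (nonEdges G) ≡ n * (n ∸ 1)
length-edges+nonEdges {n} G = begin
  2 * length (edges G) + 2 * length (nonEdges G)
    ≡⟨ *-distribˡ-+ 2 (length (edges G)) _ ⟨
  2 * (length (edges G) + length (nonEdges G))
    ≡⟨ cong (2 *_) (cong₂ _+_ (length-filter≡∑ edge? V²) (length-filter≡∑ nonEdge? V²)) ⟩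
  2 * (∑ V² (λ e → 𝟙 (edge? e)) + ∑ V² (λ e → 𝟙 (nonEdge? e)))
    ≡⟨ cong (2 *_) (∑-+ (λ e → 𝟙 (edge? e)) (λ e → 𝟙 (nonEdge? e)) V²) ⟨
  2 * (∑[ e ∈ V² ] (𝟙 (edge? e) + 𝟙 (nonEdge? e)))
    ≡⟨ cong (2 *_) (∑-cong split V²) ⟩
  2 * (∑[ (u , v) ∈ V² ] 𝟙 (u <? v))
    ≡⟨ ∑-<-pairs n ⟩
  n * (n ∸ 1) ∎
  where
  open ≡-Reasoning
  V² : List (Fin n × Fin n)
  V² = cartesianProduct (allFin n) (allFin n)
  edge? : Decidable₁ (λ ((u , v) : Fin n × Fin n) → u Fin.< v × Adj G u v)
  edge? (u , v) = (u <? v) ×-dec adj? G u v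
  nonEdge? : Decidable₁ (λ ((u , v) : Fin n × Fin n) → u Fin.< v × ¬ Adj G u v)
  nonEdge? (u , v) = (u <? v) ×-dec ¬? (adj? G u v)
  split : ∀ e → 𝟙 (edge? e) + 𝟙 (nonEdge? e) ≡ 𝟙 (proj₁ e <? proj₂ e)
  split (u , v) = 𝟙-split (u <? v) (adj? G u v)

twice-nonEdges : ∀ {n} (G : Graph n) →
  n * (n ∸ 1) ∸ 2 * length (edges G) ≡ 2 * length (nonEdges G)
twice-nonEdges G =
  trans (cong (_∸ 2 * length (edges G)) (sym (length-edges+nonEdges G)))
        (m+n∸m≡n (2 * length (edges G)) _)

-- Since n (n - 1) is twice m + N, both the integer division and the truncated subtraction are
-- exact.
length-nonEdges : ∀ {n} (G : Graph n) →
  n * (n ∸ 1) / 2 ∸ length (edges G) ≡ length (nonEdges G)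
length-nonEdges {n} G = begin
  n * (n ∸ 1) / 2 ∸ m       ≡⟨ cong (λ t → t / 2 ∸ m) (length-edges+nonEdges G) ⟨
  (2 * m + 2 * N) / 2 ∸ m   ≡⟨ cong (λ t → t / 2 ∸ m) (factor m N) ⟩
  (m + N) * 2 / 2 ∸ m       ≡⟨ cong (_∸ m) (m*n/n≡m (m + N) 2) ⟩
  m + N ∸ m                 ≡⟨ m+n∸m≡n m N ⟩
  N                         ∎
  where
  open ≡-Reasoning
  m = length (edges G)
  N = length (nonEdges G)
  factor : ∀ a b → 2 * a + 2 * b ≡ (a + b) * 2
  factor = solve-∀

diam≤⇔dist≤ : ∀ {n} (H : Graph n) (conn : Connected H) k →
              diam H conn ≤ k ⇔ (∀ u v → dist H conn u v ≤ k)
diam≤⇔dist≤ {n} H conn k = mk⇔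
  (λ diam≤k u v → ≤-trans
    (All.lookup (All.map⁻ (xs≤max 0 (map (uncurry (dist H conn)) V²)))
                (∈-cartesianProduct⁺ (∈-allFin u) (∈-allFin v)))
    diam≤k)
  -- `z≤n` handles the default value 0 of `max`.
  (λ dist≤k → max≤v⁺ z≤n (All.map⁺ (All.universal (λ (u , v) → dist≤k u v) V²)))
  where
  V² : List (Fin n × Fin n)
  V² = cartesianProduct (allFin n) (allFin n)

-- Two distinct vertices force n ≥ 2. This makes the lower bounds on the statuses positive, as
-- cancelling a factor in the case of `S₂` requires.
≢⇒nonZero-n∸1+ : ∀ {n} {u v : Fin n} → u ≢ v → ∀ k → NonZero ((n ∸ 1) + k)
≢⇒nonZero-n∸1+ {1} {Fin.zero} {Fin.zero} u≢v _ = contradiction refl u≢v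
≢⇒nonZero-n∸1+ {suc (suc _)}             _   _ = _

-- Distances in the complement.

module _ {n} (G : Graph n) (conn : Connected (complement G)) where

  private
    H : Graph n
    H = complement G

    d : Fin n → Fin n → ℕ
    d = dist H conn

    σ : Fin n → ℕ
    σ = status H conn

  -- This is the distance in `H` cut off at 2. The two indicators are kept apart because, summed
  -- over `v`, they give n - 1 and the degree of `u`.
  distBound : Fin n → Fin n → ℕ
  distBound u v = 𝟙 (¬? (u ≟ v)) + 𝟙 (adj? G u v)

  distBound≤2 : ∀ u v → distBound u v ≤ 2
  distBound≤2 u v with u ≟ v | adj? G u v
  ... | yes _ | yes _ = s≤s z≤n
  ... | yes _ | no  _ = z≤n
  ... | no  _ | yes _ = s≤s (s≤s z≤n)
  ... | no  _ | no  _ = s≤s z≤n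

  -- An empty walk makes both indicators vanish, a single edge of `H` rules out adjacency in `G`,
  -- and from length 2 on the absolute bound 2 suffices.
  distBound≤walk : ∀ {u v k} → Walk H u v k → distBound u v ≤ k
  distBound≤walk {u} [] with u ≟ u | adj? G u u
  ... | no u≢u | _       = contradiction refl u≢u
  ... | yes _  | yes u~u = contradiction u~u (adj-irrefl G refl)
  ... | yes _  | no _    = z≤n
  distBound≤walk {u} {v} ((u≢v , u≁v) ∷ []) with u ≟ v | adj? G u v
  ... | yes u≡v | _       = contradiction u≡v u≢v
  ... | no _    | yes u~v = contradiction u~v u≁v
  ... | no _    | no _    = s≤s z≤n
  distBound≤walk {u} {v} (_ ∷ _ ∷ _) = ≤-trans (distBound≤2 u v) (s≤s (s≤s z≤n))

  distBound≤dist : ∀ u v → distBound u v ≤ d u v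
  distBound≤dist u v = distBound≤walk (proj₁ (proj₁ (proj₂ (shortestPath H conn u v))))

  dist-minimal : ∀ {u v j} → Path H u v j → d u v ≤ j
  dist-minimal {u} {v} {j} = proj₂ (proj₂ (shortestPath H conn u v)) j

  -- Equal vertices are joined by the one-vertex path, and distinct vertices not adjacent in `G` by
  -- one edge of `H`. For vertices adjacent in `G` the bound is 2, as in the hypothesis.
  dist≤2⇒dist≡distBound : ∀ u v → d u v ≤ 2 → d u v ≡ distBound u v
  dist≤2⇒dist≡distBound u v d≤2 = ≤-antisym upper (distBound≤dist u v)
    where
    upper : d u v ≤ distBound u v
    upper with u ≟ v | adj? G u v
    ... | yes refl | _       = ≤-trans (dist-minimal ([] , [] ∷ [])) z≤n
    ... | no _     | yes _   = d≤2
    ... | no u≢v   | no u≁v  = dist-minimal ((u≢v , u≁v) ∷ [] , (u≢v ∷ []) ∷ [] ∷ [])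

  -- Statuses in the complement.

  statusBound : Fin n → ℕ
  statusBound u = (n ∸ 1) + degree G u

  ∑distBound≡statusBound : ∀ u → ∑ (allFin n) (distBound u) ≡ statusBound u
  ∑distBound≡statusBound u =
    trans (∑-+ (λ v → 𝟙 (¬? (u ≟ v))) (λ v → 𝟙 (adj? G u v)) (allFin n))
          (cong₂ _+_ (∑-≢ u) (sym (length-filter≡∑ (adj? G u) (allFin n))))

  statusBound≤status : ∀ u → statusBound u ≤ σ u
  statusBound≤status u =
    ≤-trans (≤-reflexive (sym (∑distBound≡statusBound u)))
            (∑-mono-≤ (distBound≤dist u) (allFin n))

  dist≤2⇒status≡statusBound : (∀ u v → d u v ≤ 2) → ∀ u → σ u ≡ statusBound u
  dist≤2⇒status≡statusBound d≤2 u =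
    trans (∑-cong (λ v → dist≤2⇒dist≡distBound u v (d≤2 u v)) (allFin n))
          (∑distBound≡statusBound u)

  -- Tightness of the sum passes to each summand, so every distance from `u` equals its bound, which
  -- never exceeds 2.
  status≡statusBound⇒dist≤2 : ∀ u → σ u ≡ statusBound u → ∀ v → d u v ≤ 2
  status≡statusBound⇒dist≤2 u eq v = ≤-trans
    (≤-reflexive (∑-tight (distBound≤dist u) (trans eq (sym (∑distBound≡statusBound u)))
                          (∈-allFin v)))
    (distBound≤2 u v)

  -- Shared by the equality cases of `S₁` and `S₂`: each of them yields tight statuses at the ends
  -- of listed edges, and connectedness carries this to all pairs of vertices.
  dist≤2-by-edges :
    (∀ u v → Adj H u v → (u , v) ∈ edges H → σ u ≡ statusBound u × σ v ≡ statusBound v) →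
    ∀ u v → d u v ≤ 2
  dist≤2-by-edges tight u v = along (proj₁ (proj₂ (conn u v)))
    where
    edge : ∀ {x y} → x Fin.< y → Adj H x y → (x , y) ∈ edges H
    edge {x} {y} x<y x~y = ∈-filter⁺ (λ (u , v) → (u <? v) ×-dec adj? H u v)
      (∈-cartesianProduct⁺ (∈-allFin x) (∈-allFin y)) (x<y , x~y)
    -- `edges H` lists an edge only in increasing order, so `x` may be either component of the
    -- listed pair.
    endpoint : ∀ {x y} → Adj H x y → σ x ≡ statusBound x
    endpoint {x} {y} x~y with Fin.<-cmp x y
    ... | tri< x<y _ _ = proj₁ (tight x y x~y (edge x<y x~y))
    ... | tri≈ _ x≡y _ = contradiction x≡y (proj₁ x~y)
    ... | tri> _ _ y<x = proj₂ (tight y x y~x (edge y<x y~x))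
      where
      y~x : Adj H y x
      y~x = adj-sym H {x} {y} x~y
    -- The first edge of a walk shows that `x` has tight status, which bounds its distance to every
    -- vertex. The empty walk covers x = y, and with it the one-vertex graph.
    along : ∀ {x y k} → Walk H x y k → d x y ≤ 2
    along []                = ≤-trans (dist-minimal ([] , [] ∷ [])) z≤n
    along {x} {y} (x~w ∷ _) = status≡statusBound⇒dist≤2 x (endpoint x~w) y

  -- Bounds for the two status indices and their equality cases.

  S₁-bound S₂-bound : ℕ
  S₁-bound = ∑[ (u , v) ∈ edges H ] (statusBound u + statusBound v)
  S₂-bound = ∑[ (u , v) ∈ edges H ] (statusBound u * statusBound v)

  private
    +-bound : ∀ ((u , v) : Fin n × Fin n) → statusBound u + statusBound v ≤ σ u + σ v
    +-bound (u , v) = +-mono-≤ (statusBound≤status u) (statusBound≤status v)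

    *-bound : ∀ ((u , v) : Fin n × Fin n) → statusBound u * statusBound v ≤ σ u * σ v
    *-bound (u , v) = *-mono-≤ (statusBound≤status u) (statusBound≤status v)

  S₁-bound≤S₁ : S₁-bound ≤ S₁ H conn
  S₁-bound≤S₁ = ∑-mono-≤ +-bound (edges H)

  S₂-bound≤S₂ : S₂-bound ≤ S₂ H conn
  S₂-bound≤S₂ = ∑-mono-≤ *-bound (edges H)

  S₁-tight⇔dist≤2 : S₁ H conn ≡ S₁-bound ⇔ (∀ u v → d u v ≤ 2)
  S₁-tight⇔dist≤2 = mk⇔
    (λ eq → dist≤2-by-edges λ u v _ uv∈E →
      +-tight (statusBound≤status u) (statusBound≤status v)
        (∑-tight +-bound eq uv∈E))
    (λ d≤2 → ∑-cong
      (λ (u , v) → cong₂ _+_ (dist≤2⇒status≡statusBound d≤2 u) (dist≤2⇒status≡statusBound d≤2 v))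
      (edges H))

  -- Tightness on an edge concerns a product of statuses. Cancelling the positive bound at one end
  -- gives tightness at the other.
  S₂-tight⇔dist≤2 : S₂ H conn ≡ S₂-bound ⇔ (∀ u v → d u v ≤ 2)
  S₂-tight⇔dist≤2 = mk⇔
    (λ eq → dist≤2-by-edges λ u v (u≢v , _) uv∈E →
      let σσ≡ = ∑-tight *-bound eq uv∈E
      in *-tightˡ {{≢⇒nonZero-n∸1+ u≢v (degree G v)}}
           (statusBound≤status u) (statusBound≤status v) σσ≡
       -- The same cancellation with the factors commuted, now for the status of `v`.
       , *-tightˡ {{≢⇒nonZero-n∸1+ u≢v (degree G u)}}
           (statusBound≤status v) (statusBound≤status u)
           (trans (*-comm (σ v) (σ u)) (trans σσ≡ (*-comm (statusBound u) (statusBound v)))))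
    (λ d≤2 → ∑-cong
      (λ (u , v) → cong₂ _*_ (dist≤2⇒status≡statusBound d≤2 u) (dist≤2⇒status≡statusBound d≤2 v))
      (edges H))

  S₁-bound≡ : S₁-bound ≡ (n ∸ 1) * (n * (n ∸ 1) ∸ 2 * length (edges G)) + M̄₁ G
  S₁-bound≡ rewrite edges-complement G | twice-nonEdges G =
    ∑-shift-+ (n ∸ 1) (degree G) (nonEdges G)

  S₂-bound≡ : S₂-bound ≡ (n ∸ 1) ^ 2 * (n * (n ∸ 1) / 2 ∸ length (edges G))
                         + (n ∸ 1) * M̄₁ G + M̄₂ G
  S₂-bound≡ rewrite edges-complement G | length-nonEdges G =
    ∑-shift-* (n ∸ 1) (degree G) (nonEdges G)

proposition2p4 :
    ∀ (n m : ℕ) (G : Graph n) → length (edges G) ≡ m →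
    (conn : Connected (complement G)) →
    let rhs₁ = (n ∸ 1) * (n * (n ∸ 1) ∸ 2 * m) + M̄₁ G
        rhs₂ = (n ∸ 1) ^ 2 * (n * (n ∸ 1) / 2 ∸ m) + (n ∸ 1) * M̄₁ G + M̄₂ G
    in (S₁ (complement G) conn ≥ rhs₁)
       × (S₂ (complement G) conn ≥ rhs₂)
       × (S₁ (complement G) conn ≡ rhs₁ ⇔ diam (complement G) conn ≤ 2)
       × (S₂ (complement G) conn ≡ rhs₂ ⇔ diam (complement G) conn ≤ 2)
proposition2p4 n _ G refl conn =
    ≤-trans (≤-reflexive (sym rhs₁≡)) (S₁-bound≤S₁ G conn)
  , ≤-trans (≤-reflexive (sym rhs₂≡)) (S₂-bound≤S₂ G conn)
  -- Tightness and diameter at most 2 are each equivalent to all distances being at most 2.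
  , ⇔-trans (rewriteʳ rhs₁≡ (S₁-tight⇔dist≤2 G conn)) (⇔-sym diam≤2⇔)
  , ⇔-trans (rewriteʳ rhs₂≡ (S₂-tight⇔dist≤2 G conn)) (⇔-sym diam≤2⇔)
  where
  rhs₁≡ = S₁-bound≡ G conn
  rhs₂≡ = S₂-bound≡ G conn
  diam≤2⇔ = diam≤⇔dist≤ (complement G) conn 2
  rewriteʳ : ∀ {a b c} {Q : Set} → b ≡ c → a ≡ b ⇔ Q → a ≡ c ⇔ Q
  rewriteʳ refl a≡b⇔Q = a≡b⇔Q
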